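{- Let $A$ be an infinite subset of $\mathbb{N}$, let $n_0$ be such that $r(A,n)\neq 1$ for all $n\ge n_0$, and let $a_0\in A$ with $a_0\ge n_0$. Then for all sufficiently large $x$ the following holds: if $$|A(x)|\le \left(\frac{\log x}{\log\log x}\right)^2$$ and $b$ is a real number with $$a_0\le b\le \frac{x}{(\log x)^2},$$ then there exists $a\in A$ with $a>3b$ and $a+b<x$ such that $$[a-b,a)\cap A=\emptyset \quad\text{and}\quad |(b,a+b]\cap A|\ge \frac{a+b}{2b}-1.$$
   Context: $\mathbb{N}$ is the set of all natural numbers. For a set $A\subseteq\mathbb{N}$ and $n\in\mathbb{N}$, $r(A,n)$ denotes the number of solutions of the equation $n=a+b$ with $a,b\in A$ and $a\le b$. For real $x$, $A(x)$ is the set of integers in $A$ that are less than or equal to $x$, and $|A(x)|$ is its cardinality. $\log$ is the natural logarithm. Intervals are intervals of real numbers. "Sufficiently large $x$" means all real $x\ge x_0$ for some threshold $x_0$ that may depend on $A$, $n_0$ and $a_0$ but not on $b$. -}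

module Defs where

open import Algebra.Bundles using (CommutativeRing; Semiring)
import Algebra.Definitions.RawSemiring as SemiringDefs
open import Axiom.ExcludedMiddle using (ExcludedMiddle)
open import Data.Fin.Base using (toℕ)
open import Data.List.Base using (List; length)
open import Data.List.Membership.Propositional using () renaming (_∈_ to _∈ₗ_)
open import Data.List.Relation.Unary.Unique.Propositional using (Unique)
open import Data.Nat.Base as ℕ using (ℕ; suc)
open import Data.Product.Base using (∃; _×_; _,_)
open import Function.Bundles using (_⇔_)
open import Level using (0ℓ) renaming (suc to lsuc)
open import Relation.Binary.Core using (Rel)
open import Relation.Binary.PropositionalEquality.Core using (_≡_)
import Relation.Binary.Construct.NonStrictToStrict as NonStrictToStrict
open import Relation.Binary.Structures using (IsTotalOrder)
open import Relation.Nullary using (¬_; yes; no)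
open import Relation.Unary using (Pred; _∈_; _∩_; _⊢_)

-- xs lists the elements of P, each exactly once.
Enumerates : {X : Set} → Pred X 0ℓ → List X → Set
Enumerates P xs = Unique xs × (∀ x → x ∈ₗ xs ⇔ x ∈ P)

Finite : {X : Set} → Pred X 0ℓ → Set
Finite P = ∃ (Enumerates P)

Infinite : {X : Set} → Pred X 0ℓ → Set
Infinite P = ¬ Finite P

-- Sets are arbitrary predicates, so excluded middle is what makes the
-- cardinality an honest number.  Infinite sets get the dummy value 0.
card : ExcludedMiddle 0ℓ → {X : Set} → Pred X 0ℓ → ℕ
card em P with em {Finite P}
... | yes (xs , _) = length xs
... | no  _        = 0

r : ExcludedMiddle 0ℓ → Pred ℕ 0ℓ → ℕ → ℕ
r em A n = card em {ℕ × ℕ} λ (a , b) → n ≡ a ℕ.+ b × a ∈ A × b ∈ A × a ℕ.≤ b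

-- The axioms characterising ℝ up to unique isomorphism.  As is usual in a
-- classical setting, _⁻¹ and sup are total functions: nothing is assumed
-- about 0# ⁻¹ (beyond congruence), nor about the supremum of a set which is
-- empty or not bounded above.
record CompleteOrderedField : Set (lsuc 0ℓ) where
  infix  4 _≤_
  infix  9 _⁻¹
  field
    commutativeRing : CommutativeRing 0ℓ 0ℓ

  open CommutativeRing commutativeRing public renaming (Carrier to ℝ)

  field
    0≉1          : 0# ≉ 1#
    _⁻¹          : ℝ → ℝ
    ⁻¹-cong      : ∀ {x y} → x ≈ y → x ⁻¹ ≈ y ⁻¹
    ⁻¹-inverseʳ  : ∀ x → x ≉ 0# → x * x ⁻¹ ≈ 1#
    _≤_          : Rel ℝ 0ℓ
    isTotalOrder : IsTotalOrder _≈_ _≤_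
    +-monoˡ-≤    : ∀ z {x y} → x ≤ y → x + z ≤ y + z
    *-nonNeg     : ∀ {x y} → 0# ≤ x → 0# ≤ y → 0# ≤ x * y

  UpperBound : Pred ℝ 0ℓ → Pred ℝ 0ℓ
  UpperBound S u = ∀ x → x ∈ S → x ≤ u

  field
    sup       : Pred ℝ 0ℓ → ℝ
    sup-upper : ∀ S → ∃ S → ∃ (UpperBound S) → sup S ∈ UpperBound S
    sup-least : ∀ S → ∃ S → ∃ (UpperBound S) →
                ∀ u → u ∈ UpperBound S → sup S ≤ u

  open NonStrictToStrict _≈_ _≤_ public using (_<_)
  open SemiringDefs (Semiring.rawSemiring semiring) public using (sum; _^_)

  infixl 7 _/_
  _/_ : ℝ → ℝ → ℝ
  x / y = x * y ⁻¹

  fromℕ : ℕ → ℝ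
  fromℕ n = SemiringDefs._×_ (Semiring.rawSemiring semiring) n 1#

  -- The half-open intervals [ u , v ) and ( u , v ].
  [_,_⟩ ⟨_,_] : ℝ → ℝ → Pred ℝ 0ℓ
  [ u , v ⟩ t = u ≤ t × t < v
  ⟨ u , v ] t = u < t × t ≤ v

  infix 8 _⋒_
  -- The naturals of A whose image in ℝ lies in I.
  _⋒_ : Pred ℕ 0ℓ → Pred ℝ 0ℓ → Pred ℕ 0ℓ
  A ⋒ I = A ∩ (fromℕ ⊢ I)

  -- The set A(x).
  infix 8 _⟨≤_⟩
  _⟨≤_⟩ : Pred ℕ 0ℓ → ℝ → Pred ℕ 0ℓ
  A ⟨≤ x ⟩ = A ⋒ (_≤ x)

  -- Right-endpoint Riemann sum of ∫₁ˣ dt/t with m + 1 equal steps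
  -- h = (x - 1)/(m + 1), namely ∑ h/(1 + k h) over 1 ≤ k ≤ m + 1.  The
  -- integrand being decreasing, this is the lower sum of the partition
  -- when x ≥ 1, and also when 0 < x < 1, where h is negative.
  lowerSum : ℝ → ℕ → ℝ
  lowerSum x m = sum {suc m} λ i → h / (1# + fromℕ (suc (toℕ i)) * h)
    where h = (x - 1#) / fromℕ (suc m)

  -- log x = ∫₁ˣ dt/t for x > 0, the supremum of its lower sums (uniform
  -- partitions suffice, as they become arbitrarily fine).  No meaning for x ≤ 0.
  log : ℝ → ℝ
  log x = sup λ y → ∃ λ m → y ≈ lowerSum x m

-- Since r(A, 2a) ≠ 1 for a ∈ A with a ≥ n₀, the representation a + a is not the
-- only one, so A has an element in (a, 2a].  Walk down A from an element c > b.
-- While consecutive elements are at most b apart, A has at least c/b - 1 elements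
-- in (b, c]; the loss at the bottom of the walk is compensated by an element of
-- A in (b, 2b].  If instead a gap of length b below some a > 3b is met, then,
-- for the lowest such a, the same count up to the predecessor p ≥ a/2 of a gives
-- the required a/(2b) elements.  A gap does occur below x: otherwise, starting
-- from the last c ∈ A with c + b < x, one finds about x/(2b) ≥ (log x)²/2 elements
-- up to x, too many as soon as log log x ≥ 2 and log x ≥ 3.
module Submission where

open import Defs
open import Axiom.ExcludedMiddle using (ExcludedMiddle)
import Algebra.Properties.Group as GroupProperties
import Algebra.Properties.Monoid.Mult as MonoidMult
import Algebra.Properties.Ring as RingProperties
import Algebra.Properties.Semiring.Mult as SemiringMult
import Algebra.Solver.Ring.NaturalCoefficients.Default as NaturalCoefficients
open import Data.Fin.Base using (Fin; zero; suc; toℕ)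
open import Data.Fin.Properties using (toℕ<n)
open import Data.List.Base using (List; []; _∷_; length; filter; upTo; _++_)
open import Data.List.Membership.Propositional using () renaming (_∈_ to _∈ₗ_)
open import Data.List.Membership.Propositional.Properties using (∈-∃++; ∈-filter⁺; ∈-filter⁻; ∈-upTo⁺)
open import Data.List.Relation.Binary.Permutation.Propositional using (_↭_)
open import Data.List.Relation.Binary.Permutation.Propositional.Properties using (shift; ∈-resp-↭; ↭-length)
open import Data.List.Relation.Unary.All as All using (All; []; _∷_)
open import Data.List.Relation.Unary.AllPairs using ([]; _∷_)
open import Data.List.Relation.Unary.Any using (here; there)
open import Data.List.Relation.Unary.Unique.Propositional using (Unique)
open import Data.List.Relation.Unary.Unique.Propositional.Properties using (filter⁺; upTo⁺)
open import Data.Nat.Base as ℕ using (ℕ; zero; suc; z≤n; s≤s) renaming (_≤_ to _≤ℕ_; _<_ to _<ℕ_)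
open import Data.Nat.Induction using (<-rec)
import Data.Nat.Properties as ℕₚ
open import Data.Product.Base using (_×_; ∃; ∃₂; ∃-syntax; _,_; proj₁; proj₂)
open import Data.Sum.Base using (_⊎_; inj₁; inj₂)
open import Function.Base using (_∘_)
open import Function.Bundles using (Equivalence; mk⇔)
open import Level using (0ℓ)
open import Relation.Binary.Bundles using (Poset)
import Relation.Binary.Construct.NonStrictToStrict as NonStrictToStrict
open import Relation.Binary.PropositionalEquality.Core as ≡ using (_≡_; _≢_)
import Relation.Binary.Reasoning.PartialOrder as PartialOrderReasoning
open import Relation.Binary.Structures using (IsTotalOrder)
open import Relation.Nullary using (¬_; yes; no; contradiction)
open import Relation.Nullary.Decidable using (decidable-stable; from-no)
open import Relation.Unary using (Pred; _∈_; _⊆_; Decidable; Empty)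

-- Cardinality through lists without repetition.

Unique-⊆⇒length≤ : {X : Set} {xs ys : List X} → Unique xs → All (_∈ₗ ys) xs → length xs ≤ℕ length ys
Unique-⊆⇒length≤ [] [] = z≤n
-- Pigeonhole: `x` is moved to the front of `ys` and deleted. Since `x` does not recur in `xs`, the
-- rest of `xs` survives in what remains.
Unique-⊆⇒length≤ {X} {x ∷ xs} {ys} (x∉xs ∷ unique) (x∈ys ∷ xs⊆ys) with ∈-∃++ x∈ys
... | as , bs , ≡.refl = begin
  suc (length xs)           ≤⟨ s≤s (Unique-⊆⇒length≤ unique (All.tabulate xs⊆rest)) ⟩
  suc (length (as ++ bs))   ≡⟨ ↭-length moved ⟨
  length (as ++ x ∷ bs)     ∎
  where
  open ℕₚ.≤-Reasoning
  moved : as ++ x ∷ bs ↭ x ∷ as ++ bs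
  moved = shift x as bs
  xs⊆rest : ∀ {z} → z ∈ₗ xs → z ∈ₗ as ++ bs
  xs⊆rest z∈xs with ∈-resp-↭ moved (All.lookup xs⊆ys z∈xs)
  ... | here z≡x  = contradiction (≡.sym z≡x) (All.lookup x∉xs z∈xs)
  ... | there z∈  = z∈

module Cardinality (em : ExcludedMiddle 0ℓ) {X : Set} where

  -- `card` uses whichever enumeration excluded middle supplies. Two repetition-free lists of the
  -- same set contain each other, so their lengths agree.
  Enumerates⇒card : {P : Pred X 0ℓ} {xs : List X} → Enumerates P xs → card em P ≡ length xs
  Enumerates⇒card {P} {xs} (unique , mem) with em {Finite P}
  ... | no infinite = contradiction (xs , unique , mem) infinite
  ... | yes (ys , unique′ , mem′) = ℕₚ.≤-antisym
    (Unique-⊆⇒length≤ unique′ (All.tabulate λ {z} → from (mem z) ∘ to (mem′ z)))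
    (Unique-⊆⇒length≤ unique (All.tabulate λ {z} → from (mem′ z) ∘ to (mem z)))
    where open Equivalence

  -- The list only has to consist of elements of `P`, so the empty list accounts for the dummy value
  -- 0 of an infinite `P`. This lets the comparisons below ask for finiteness of the larger set
  -- alone.
  card-attained : (P : Pred X 0ℓ) → ∃[ xs ] Unique xs × All P xs × card em P ≡ length xs
  card-attained P with em {Finite P}
  ... | yes (xs , unique , mem) = xs , unique , All.tabulate (λ {z} → Equivalence.to (mem z)) , ≡.refl
  ... | no _                    = [] , [] , [] , ≡.refl

  length≤card : {P : Pred X 0ℓ} {xs : List X} → Finite P → Unique xs → All P xs → length xs ≤ℕ card em P
  length≤card (ys , unique′ , mem) unique all
    rewrite Enumerates⇒card (unique′ , mem) =
    Unique-⊆⇒length≤ unique (All.map (λ {z} → Equivalence.from (mem z)) all)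

  card-mono : {P Q : Pred X 0ℓ} → Finite Q → P ⊆ Q → card em P ≤ℕ card em Q
  card-mono {P} finite P⊆Q with card-attained P
  ... | xs , unique , all , eq rewrite eq = length≤card finite unique (All.map P⊆Q all)

  card-mono-< : {P Q : Pred X 0ℓ} {x : X} → Finite Q → P ⊆ Q → x ∈ Q → ¬ x ∈ P → card em P <ℕ card em Q
  card-mono-< {P} {Q} {x} finite P⊆Q x∈Q x∉P with card-attained P
  ... | xs , unique , all , eq rewrite eq =
    length≤card finite
      (All.map (λ z∈P x≡z → x∉P (≡.subst P (≡.sym x≡z) z∈P)) all ∷ unique)
      (x∈Q ∷ All.map P⊆Q all)

  -- If `x` were the only element, the list `x ∷ []` would enumerate `P`.
  card≢1⇒another : {P : Pred X 0ℓ} → card em P ≢ 1 → ∀ {x} → x ∈ P → ∃[ y ] y ∈ P × y ≢ x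
  card≢1⇒another {P} card≢1 {x} x∈P with em {∃[ y ] y ∈ P × y ≢ x}
  ... | yes another = another
  ... | no  none    = contradiction (Enumerates⇒card enumerates) card≢1
    where
    enumerates : Enumerates P (x ∷ [])
    enumerates = ([] ∷ []) , λ y → mk⇔
      (λ { (here ≡.refl) → x∈P })
      (λ y∈P → here (decidable-stable em λ y≢x → none (y , y∈P , y≢x)))

bounded⇒finite : ExcludedMiddle 0ℓ → {P : Pred ℕ 0ℓ} (N : ℕ) → (∀ {k} → k ∈ P → k <ℕ N) → Finite P
bounded⇒finite em {P} N bound =
  filter P? (upTo N) , filter⁺ P? (upTo⁺ N) ,
  λ k → mk⇔ (proj₂ ∘ ∈-filter⁻ P? {xs = upTo N}) (λ k∈P → ∈-filter⁺ P? (∈-upTo⁺ (bound k∈P)) k∈P)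
  where
  P? : Decidable P
  P? k = em

-- Growth of a set in which no large number has exactly one representation.

module NoUniqueSums (em : ExcludedMiddle 0ℓ) (A : Pred ℕ 0ℓ)
  (n₀ : ℕ) (r≢1 : ∀ n → n₀ ≤ℕ n → r em A n ≢ 1) where

  next : ∀ {a} → a ∈ A → n₀ ≤ℕ a → ∃[ v ] v ∈ A × a <ℕ v × v ≤ℕ a ℕ.+ a
  next {a} a∈A n₀≤a
    with Cardinality.card≢1⇒another em (r≢1 (a ℕ.+ a) (ℕₚ.≤-trans n₀≤a (ℕₚ.m≤m+n a a)))
           (≡.refl , a∈A , a∈A , ℕₚ.≤-refl)
  ... | (u , v) , (a+a≡u+v , _ , v∈A , u≤v) , uv≢aa = v , v∈A , a<v , v≤a+a
    where
    v≤a+a : v ≤ℕ a ℕ.+ a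
    v≤a+a rewrite a+a≡u+v = ℕₚ.m≤n+m v u
    a<v : a <ℕ v
    -- From u ≤ v ≤ a and u + v = a + a it would follow that u = v = a, the representation already
    -- excluded.
    a<v = ℕₚ.≰⇒> λ v≤a →
      let a≤v = ℕₚ.+-cancelˡ-≤ a a v (ℕₚ.≤-trans (ℕₚ.≤-reflexive a+a≡u+v) (ℕₚ.+-monoˡ-≤ v (ℕₚ.≤-trans u≤v v≤a)))
          v≡a = ℕₚ.≤-antisym v≤a a≤v
          u≡a = ℕₚ.+-cancelʳ-≡ v u a (≡.trans (≡.sym a+a≡u+v) (≡.cong (a ℕ.+_) (≡.sym v≡a)))
      in uv≢aa (≡.cong₂ _,_ u≡a v≡a)

  -- Iterating `next` from `a₀` must leave the bounded set `Q`. The step that leaves it joins two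
  -- elements of `A` whose ratio is at most 2. `Q` will be a set of numbers below some threshold.
  crossing : {Q : Pred ℕ 0ℓ} (N : ℕ) → (∀ {k} → k ∈ Q → k <ℕ N) →
    ∀ {a₀} → a₀ ∈ A → n₀ ≤ℕ a₀ → a₀ ∈ Q →
    ∃₂ λ p v → (p ∈ A × p ∈ Q) × (v ∈ A × ¬ v ∈ Q) × v ≤ℕ p ℕ.+ p
  crossing {Q} N bound {a₀} a₀∈A n₀≤a₀ a₀∈Q = climb N a₀∈A ℕₚ.≤-refl a₀∈Q (ℕₚ.m≤m+n N a₀)
    where
    -- Each step raises `a` by at least 1, so one unit of fuel per step preserves N ≤ fuel + a. With
    -- no fuel left, a ≥ N contradicts a ∈ Q.
    climb : ∀ fuel {a} → a ∈ A → a₀ ≤ℕ a → a ∈ Q → N ≤ℕ fuel ℕ.+ a →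
      ∃₂ λ p v → (p ∈ A × p ∈ Q) × (v ∈ A × ¬ v ∈ Q) × v ≤ℕ p ℕ.+ p
    climb zero a∈A a₀≤a a∈Q N≤a = contradiction (bound a∈Q) (ℕₚ.≤⇒≯ N≤a)
    climb (suc fuel) {a} a∈A a₀≤a a∈Q N≤ with next a∈A (ℕₚ.≤-trans n₀≤a₀ a₀≤a)
    ... | v , v∈A , a<v , v≤a+a with em {v ∈ Q}
    ...   | no  v∉Q = a , v , (a∈A , a∈Q) , (v∈A , v∉Q) , v≤a+a
    ...   | yes v∈Q = climb fuel v∈A (ℕₚ.≤-trans a₀≤a (ℕₚ.<⇒≤ a<v)) v∈Q (begin
      N               ≤⟨ N≤ ⟩
      suc fuel ℕ.+ a  ≡⟨ ℕₚ.+-suc fuel a ⟨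
      fuel ℕ.+ suc a  ≤⟨ ℕₚ.+-monoʳ-≤ fuel a<v ⟩
      fuel ℕ.+ v      ∎)
      where open ℕₚ.≤-Reasoning

-- Arithmetic and order in a complete ordered field.

module OrderedField (em : ExcludedMiddle 0ℓ) (reals : CompleteOrderedField) where
  open CompleteOrderedField reals public hiding (zero)
  open IsTotalOrder isTotalOrder public
    using (total; antisym; isPartialOrder)
    renaming (refl to ≤-refl; reflexive to ≤-reflexive; trans to ≤-trans)

  poset : Poset 0ℓ 0ℓ 0ℓ
  poset = record { isPartialOrder = isPartialOrder }

  open PartialOrderReasoning poset public
  open NonStrictToStrict _≈_ _≤_ public using (<⇒≤)
  open NaturalCoefficients commutativeSemiring public using (solve; _:+_; _:*_; _:=_; con)

  <⇒≱ : ∀ {x y} → x < y → ¬ y ≤ x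
  <⇒≱ = NonStrictToStrict.<⇒≱ _≈_ _≤_ antisym

  ≰⇒> : ∀ {x y} → ¬ x ≤ y → y < x
  ≰⇒> = NonStrictToStrict.≰⇒> _≈_ _≤_ sym ≤-reflexive total

  ≮⇒≥ : ∀ {x y} → ¬ x < y → y ≤ x
  ≮⇒≥ x≮y = decidable-stable em λ y≰x → x≮y (≰⇒> y≰x)

  <-≤-trans : ∀ {x y z} → x < y → y ≤ z → x < z
  <-≤-trans x<y y≤z = begin-strict _ <⟨ x<y ⟩ _ ≤⟨ y≤z ⟩ _ ∎

  ≤-<-trans : ∀ {x y z} → x ≤ y → y < z → x < z
  ≤-<-trans x≤y y<z = begin-strict _ ≤⟨ x≤y ⟩ _ <⟨ y<z ⟩ _ ∎

  x-y+y≈x : ∀ x y → (x - y) + y ≈ x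
  x-y+y≈x x y = GroupProperties.//-rightDividesˡ +-group y x

  x+y-y≈x : ∀ x y → (x + y) - y ≈ x
  x+y-y≈x x y = GroupProperties.//-rightDividesʳ +-group y x

  +-mono-≤ : ∀ {x y u v} → x ≤ y → u ≤ v → x + u ≤ y + v
  +-mono-≤ {x} {y} {u} {v} x≤y u≤v = begin
    x + u ≤⟨ +-monoˡ-≤ u x≤y ⟩
    y + u ≈⟨ +-comm y u ⟩
    u + y ≤⟨ +-monoˡ-≤ y u≤v ⟩
    v + y ≈⟨ +-comm v y ⟩
    y + v ∎

  +-cancelʳ-≤ : ∀ z {x y} → x + z ≤ y + z → x ≤ y
  +-cancelʳ-≤ z {x} {y} x+z≤y+z = begin
    x           ≈⟨ x+y-y≈x x z ⟨
    (x + z) - z ≤⟨ +-monoˡ-≤ (- z) x+z≤y+z ⟩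
    (y + z) - z ≈⟨ x+y-y≈x y z ⟩
    y           ∎

  x+y≤z⇒x≤z-y : ∀ {x y z} → x + y ≤ z → x ≤ z - y
  x+y≤z⇒x≤z-y {x} {y} {z} x+y≤z = +-cancelʳ-≤ y (≤-trans x+y≤z (≤-reflexive (sym (x-y+y≈x z y))))

  x≤z+y⇒x-y≤z : ∀ {x y z} → x ≤ z + y → x - y ≤ z
  x≤z+y⇒x-y≤z {x} {y} {z} x≤z+y = +-cancelʳ-≤ y (≤-trans (≤-reflexive (x-y+y≈x x y)) x≤z+y)

  0≤y⇒x≤x+y : ∀ x {y} → 0# ≤ y → x ≤ x + y
  0≤y⇒x≤x+y x {y} 0≤y = begin
    x      ≈⟨ +-identityʳ x ⟨
    x + 0# ≤⟨ +-mono-≤ ≤-refl 0≤y ⟩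
    x + y  ∎

  *-monoˡ-≤ : ∀ {z} → 0# ≤ z → ∀ {x y} → x ≤ y → x * z ≤ y * z
  *-monoˡ-≤ {z} 0≤z {x} {y} x≤y = begin
    x * z                 ≤⟨ 0≤y⇒x≤x+y (x * z) (*-nonNeg 0≤y-x 0≤z) ⟩
    x * z + (y - x) * z   ≈⟨ solve 3 (λ x d z → x :* z :+ d :* z := (d :+ x) :* z) refl x (y - x) z ⟩
    ((y - x) + x) * z     ≈⟨ *-congʳ (x-y+y≈x y x) ⟩
    y * z                 ∎
    where
    0≤y-x : 0# ≤ y - x
    0≤y-x = x+y≤z⇒x≤z-y (≤-trans (≤-reflexive (+-identityˡ x)) x≤y)

  *-monoʳ-≤ : ∀ {z} → 0# ≤ z → ∀ {x y} → x ≤ y → z * x ≤ z * y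
  *-monoʳ-≤ {z} 0≤z {x} {y} x≤y = begin
    z * x ≈⟨ *-comm z x ⟩
    x * z ≤⟨ *-monoˡ-≤ 0≤z x≤y ⟩
    y * z ≈⟨ *-comm y z ⟩
    z * y ∎

  *-mono-≤ : ∀ {x y u v} → 0# ≤ y → 0# ≤ u → x ≤ y → u ≤ v → x * u ≤ y * v
  *-mono-≤ 0≤y 0≤u x≤y u≤v = ≤-trans (*-monoˡ-≤ 0≤u x≤y) (*-monoʳ-≤ 0≤y u≤v)

  -- If 1 ≤ 0, then -1 is nonnegative, and hence so is its square 1.
  0≤1 : 0# ≤ 1#
  0≤1 with total 0# 1#
  ... | inj₁ 0≤1 = 0≤1
  ... | inj₂ 1≤0 = begin
    0#          ≤⟨ *-nonNeg 0≤-1 0≤-1 ⟩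
    - 1# * - 1# ≈⟨ -1*x≈-x (- 1#) ⟩
    - (- 1#)    ≈⟨ -‿involutive 1# ⟩
    1#          ∎
    where
    open RingProperties ring using (-1*x≈-x; -‿involutive)
    0≤-1 : 0# ≤ - 1#
    0≤-1 = begin
      0#         ≈⟨ -‿inverseʳ 1# ⟨
      1# + - 1#  ≤⟨ +-monoˡ-≤ (- 1#) 1≤0 ⟩
      0# + - 1#  ≈⟨ +-identityˡ (- 1#) ⟩
      - 1#       ∎

  0<1 : 0# < 1#
  0<1 = 0≤1 , 0≉1

  1≤⇒0< : ∀ {x} → 1# ≤ x → 0# < x
  1≤⇒0< = <-≤-trans 0<1

  0<⇒x*x⁻¹≈1 : ∀ {x} → 0# < x → x * x ⁻¹ ≈ 1#
  0<⇒x*x⁻¹≈1 (_ , 0≉x) = ⁻¹-inverseʳ _ (0≉x ∘ sym)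

  0≤⁻¹ : ∀ {x} → 0# < x → 0# ≤ x ⁻¹
  0≤⁻¹ {x} 0<x with total 0# (x ⁻¹)
  ... | inj₁ 0≤x⁻¹ = 0≤x⁻¹
  ... | inj₂ x⁻¹≤0 = contradiction 1≤0 (<⇒≱ 0<1)
    where
    1≤0 : 1# ≤ 0#
    1≤0 = begin
      1#        ≈⟨ 0<⇒x*x⁻¹≈1 0<x ⟨
      x * x ⁻¹  ≤⟨ *-monoʳ-≤ (<⇒≤ 0<x) x⁻¹≤0 ⟩
      x * 0#    ≈⟨ zeroʳ x ⟩
      0#        ∎

  x*y/y≈x : ∀ x {y} → 0# < y → (x * y) / y ≈ x
  x*y/y≈x x {y} 0<y = begin-equality
    (x * y) * y ⁻¹ ≈⟨ *-assoc x y (y ⁻¹) ⟩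
    x * (y * y ⁻¹) ≈⟨ *-congˡ (0<⇒x*x⁻¹≈1 0<y) ⟩
    x * 1#         ≈⟨ *-identityʳ x ⟩
    x              ∎

  x/y*y≈x : ∀ x {y} → 0# < y → (x / y) * y ≈ x
  x/y*y≈x x {y} 0<y = begin-equality
    (x * y ⁻¹) * y ≈⟨ solve 3 (λ x y i → (x :* i) :* y := (x :* y) :* i) refl x y (y ⁻¹) ⟩
    (x * y) * y ⁻¹ ≈⟨ x*y/y≈x x 0<y ⟩
    x              ∎

  x≤z*y⇒x/y≤z : ∀ {x y z} → 0# < y → x ≤ z * y → x / y ≤ z
  x≤z*y⇒x/y≤z {x} {y} {z} 0<y x≤z*y = begin
    x / y        ≤⟨ *-monoˡ-≤ (0≤⁻¹ 0<y) x≤z*y ⟩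
    (z * y) / y  ≈⟨ x*y/y≈x z 0<y ⟩
    z            ∎

  z*y≤x⇒z≤x/y : ∀ {x y z} → 0# < y → z * y ≤ x → z ≤ x / y
  z*y≤x⇒z≤x/y {x} {y} {z} 0<y z*y≤x = begin
    z            ≈⟨ x*y/y≈x z 0<y ⟨
    (z * y) / y  ≤⟨ *-monoˡ-≤ (0≤⁻¹ 0<y) z*y≤x ⟩
    x / y        ∎

  z≤x/y⇒z*y≤x : ∀ {x y z} → 0# < y → z ≤ x / y → z * y ≤ x
  z≤x/y⇒z*y≤x {x} {y} {z} 0<y z≤x/y = begin
    z * y        ≤⟨ *-monoˡ-≤ (<⇒≤ 0<y) z≤x/y ⟩
    (x / y) * y  ≈⟨ x/y*y≈x x 0<y ⟩
    x            ∎

  *-cancelʳ-≤ : ∀ {x y z} → 0# < z → x * z ≤ y * z → x ≤ y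
  *-cancelʳ-≤ {x} {y} {z} 0<z xz≤yz = ≤-trans (z*y≤x⇒z≤x/y 0<z xz≤yz) (≤-reflexive (x*y/y≈x y 0<z))

  -- The natural numbers inside the field and the Archimedean property.

  fromℕ-+ : ∀ m n → fromℕ (m ℕ.+ n) ≈ fromℕ m + fromℕ n
  fromℕ-+ = MonoidMult.×-homo-+ +-monoid 1#

  fromℕ-* : ∀ m n → fromℕ (m ℕ.* n) ≈ fromℕ m * fromℕ n
  fromℕ-* = SemiringMult.×1-homo-* semiring

  0≤fromℕ : ∀ n → 0# ≤ fromℕ n
  0≤fromℕ zero    = ≤-refl
  0≤fromℕ (suc n) = ≤-trans 0≤1 (0≤y⇒x≤x+y 1# (0≤fromℕ n))

  fromℕ-mono-≤ : ∀ {m n} → m ≤ℕ n → fromℕ m ≤ fromℕ n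
  fromℕ-mono-≤ {n = n} z≤n = 0≤fromℕ n
  fromℕ-mono-≤ (s≤s m≤n)   = +-mono-≤ ≤-refl (fromℕ-mono-≤ m≤n)

  1+x≰x : ∀ x → ¬ 1# + x ≤ x
  1+x≰x x 1+x≤x = <⇒≱ 0<1 (+-cancelʳ-≤ x (≤-trans 1+x≤x (≤-reflexive (sym (+-identityˡ x)))))

  fromℕ-cancel-≤ : ∀ {m n} → fromℕ m ≤ fromℕ n → m ≤ℕ n
  fromℕ-cancel-≤ {m} {n} m≤n = ℕₚ.≮⇒≥ λ n<m → 1+x≰x (fromℕ n) (≤-trans (fromℕ-mono-≤ n<m) m≤n)

  fromℕ-mono-< : ∀ {m n} → m <ℕ n → fromℕ m < fromℕ n
  fromℕ-mono-< m<n = ≰⇒> λ n≤m → ℕₚ.<⇒≱ m<n (fromℕ-cancel-≤ n≤m)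

  fromℕ-cancel-< : ∀ {m n} → fromℕ m < fromℕ n → m <ℕ n
  fromℕ-cancel-< m<n = ℕₚ.≰⇒> λ n≤m → <⇒≱ m<n (fromℕ-mono-≤ n≤m)

  0<fromℕ : ∀ n → 0# < fromℕ (suc n)
  0<fromℕ n = 1≤⇒0< (0≤y⇒x≤x+y 1# (0≤fromℕ n))

  -- Otherwise the naturals have a supremum s. Since n + 1 ≤ s for every n, s - 1 is also an upper
  -- bound, and s ≤ s - 1 is absurd.
  archimedean : ∀ x → ∃[ n ] x < fromℕ n
  archimedean x with em {∃[ n ] x < fromℕ n}
  ... | yes bounded = bounded
  ... | no  none    = contradiction 1+s≤s (1+x≰x s)
    where
    S : Pred ℝ 0ℓ
    S y = ∃[ n ] y ≈ fromℕ n
    nonempty : ∃ S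
    nonempty = 0# , 0 , refl
    bounded : ∃ (UpperBound S)
    bounded = x , λ { y (n , y≈n) → ≤-trans (≤-reflexive y≈n) (≮⇒≥ λ x<n → none (n , x<n)) }
    s : ℝ
    s = sup S
    s-1-bound : s - 1# ∈ UpperBound S
    s-1-bound y (n , y≈n) = x+y≤z⇒x≤z-y (begin
      y + 1#          ≈⟨ +-congʳ y≈n ⟩
      fromℕ n + 1#    ≈⟨ +-comm (fromℕ n) 1# ⟩
      fromℕ (suc n)   ≤⟨ sup-upper S nonempty bounded _ (suc n , refl) ⟩
      s               ∎)
    1+s≤s : 1# + s ≤ s
    1+s≤s = begin
      1# + s         ≤⟨ +-mono-≤ ≤-refl (sup-least S nonempty bounded (s - 1#) s-1-bound) ⟩
      1# + (s - 1#)  ≈⟨ +-comm 1# (s - 1#) ⟩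
      (s - 1#) + 1#  ≈⟨ x-y+y≈x s 1# ⟩
      s              ∎

  -- Finite sums, the harmonic series and the growth of the logarithm.

  sum-mono-≤ : ∀ {n} {f g : Fin n → ℝ} → (∀ i → f i ≤ g i) → sum f ≤ sum g
  sum-mono-≤ {zero}  f≤g = ≤-refl
  sum-mono-≤ {suc n} f≤g = +-mono-≤ (f≤g zero) (sum-mono-≤ (f≤g ∘ suc))

  sum-const : ∀ n c → sum {n} (λ _ → c) ≈ fromℕ n * c
  sum-const zero    c = sym (zeroˡ c)
  sum-const (suc n) c = begin-equality
    c + sum {n} (λ _ → c)  ≈⟨ +-congˡ (sum-const n c) ⟩
    c + fromℕ n * c        ≈⟨ solve 2 (λ c n → c :+ n :* c := (con 1 :+ n) :* c) refl c (fromℕ n) ⟩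
    fromℕ (suc n) * c      ∎

  sum-split : ∀ m {n} (f : ℕ → ℝ) →
    sum {m ℕ.+ n} (f ∘ toℕ) ≈ sum {m} (f ∘ toℕ) + sum {n} (λ i → f (m ℕ.+ toℕ i))
  sum-split zero    f = sym (+-identityˡ _)
  sum-split (suc m) f = trans (+-congˡ (sum-split m (f ∘ suc))) (sym (+-assoc _ _ _))

  -- This is 1/2 + ... + 1/(n + 1). The term 1 is absent because the lower sums for the logarithm
  -- use right endpoints.
  harmonic : ℕ → ℝ
  harmonic n = sum {n} λ i → fromℕ (2 ℕ.+ toℕ i) ⁻¹

  -- The terms 1/(n + 2), …, 1/(2n + 3) are each at least 1/(2(n + 2)).
  harmonic-step : ∀ n → 1# + fromℕ 2 * harmonic n ≤ fromℕ 2 * harmonic (n ℕ.+ (2 ℕ.+ n))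
  harmonic-step n = begin
    1# + fromℕ 2 * harmonic n                        ≈⟨ +-congʳ (0<⇒x*x⁻¹≈1 0<t) ⟨
    t * t ⁻¹ + fromℕ 2 * harmonic n                  ≈⟨ +-congʳ (*-congʳ (fromℕ-* 2 (2 ℕ.+ n))) ⟩
    fromℕ 2 * fromℕ (2 ℕ.+ n) * t ⁻¹ + fromℕ 2 * harmonic n
      ≈⟨ solve 4 (λ a b c d → a :* b :* c :+ a :* d := a :* (d :+ b :* c)) refl (fromℕ 2) (fromℕ (2 ℕ.+ n)) (t ⁻¹) (harmonic n) ⟩
    fromℕ 2 * (harmonic n + fromℕ (2 ℕ.+ n) * t ⁻¹)  ≈⟨ *-congˡ (+-congˡ (sum-const (2 ℕ.+ n) (t ⁻¹))) ⟨
    fromℕ 2 * (harmonic n + sum {2 ℕ.+ n} (λ _ → t ⁻¹))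
      ≤⟨ *-monoʳ-≤ (0≤fromℕ 2) (+-mono-≤ ≤-refl (sum-mono-≤ term)) ⟩
    fromℕ 2 * (harmonic n + sum {2 ℕ.+ n} (λ i → fromℕ (2 ℕ.+ (n ℕ.+ toℕ i)) ⁻¹))
      ≈⟨ *-congˡ (sum-split n λ k → fromℕ (2 ℕ.+ k) ⁻¹) ⟨
    fromℕ 2 * harmonic (n ℕ.+ (2 ℕ.+ n))             ∎
    where
    t : ℝ
    t = fromℕ (2 ℕ.* (2 ℕ.+ n))
    0<t : 0# < t
    0<t = 0<fromℕ (suc n ℕ.+ 1 ℕ.* (2 ℕ.+ n))
    bound : ∀ (i : Fin (2 ℕ.+ n)) → 2 ℕ.+ (n ℕ.+ toℕ i) ≤ℕ 2 ℕ.* (2 ℕ.+ n)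
    bound i = ℕₚ.+-monoʳ-≤ (2 ℕ.+ n) (ℕₚ.≤-trans (ℕₚ.<⇒≤ (toℕ<n i)) (ℕₚ.m≤m+n (2 ℕ.+ n) 0))
    term : ∀ i → t ⁻¹ ≤ fromℕ (2 ℕ.+ (n ℕ.+ toℕ i)) ⁻¹
    term i = ≤-trans (z*y≤x⇒z≤x/y (0<fromℕ (suc (n ℕ.+ toℕ i))) (begin
      t ⁻¹ * fromℕ (2 ℕ.+ (n ℕ.+ toℕ i))  ≤⟨ *-monoʳ-≤ (0≤⁻¹ 0<t) (fromℕ-mono-≤ (bound i)) ⟩
      t ⁻¹ * t                            ≈⟨ *-comm (t ⁻¹) t ⟩
      t * t ⁻¹                            ≈⟨ 0<⇒x*x⁻¹≈1 0<t ⟩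
      1#                                  ∎)) (≤-reflexive (*-identityˡ _))

  -- Each application of `harmonic-step` adds at least 1 to twice the sum, so 2c applications
  -- suffice. The index has the form `suc m` to match a lower sum with m + 1 steps.
  harmonic-unbounded : ∀ c → ∃[ m ] fromℕ c ≤ harmonic (suc m)
  harmonic-unbounded c with twice (2 ℕ.* c)
    where
    twice : ∀ k → ∃[ m ] fromℕ k ≤ fromℕ 2 * harmonic (suc m)
    twice zero = 0 , *-nonNeg (0≤fromℕ 2) (≤-trans (0≤⁻¹ (0<fromℕ 1)) (≤-reflexive (sym (+-identityʳ _))))
    twice (suc k) with twice k
    ... | m , k≤ = m ℕ.+ (2 ℕ.+ suc m) , ≤-trans (+-mono-≤ ≤-refl k≤) (harmonic-step (suc m))
  ... | m , 2c≤ = m , *-cancelʳ-≤ (0<fromℕ 1) (begin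
    fromℕ c * fromℕ 2           ≈⟨ *-comm (fromℕ c) (fromℕ 2) ⟩
    fromℕ 2 * fromℕ c           ≈⟨ fromℕ-* 2 c ⟨
    fromℕ (2 ℕ.* c)             ≤⟨ 2c≤ ⟩
    fromℕ 2 * harmonic (suc m)  ≈⟨ *-comm (fromℕ 2) (harmonic (suc m)) ⟩
    harmonic (suc m) * fromℕ 2  ∎)

  -- Every denominator is at least 1, so each of the m + 1 terms is at most h. This bounds the set
  -- whose supremum is `log x`, as `sup-upper` requires.
  lowerSum≤x-1 : ∀ {x} → 1# ≤ x → ∀ m → lowerSum x m ≤ x - 1#
  lowerSum≤x-1 {x} 1≤x m = begin
    lowerSum x m               ≤⟨ sum-mono-≤ {suc m} (λ i → term (suc (toℕ i))) ⟩
    sum {suc m} (λ _ → h)      ≈⟨ sum-const (suc m) h ⟩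
    fromℕ (suc m) * h          ≈⟨ *-comm (fromℕ (suc m)) h ⟩
    h * fromℕ (suc m)          ≈⟨ x/y*y≈x (x - 1#) (0<fromℕ m) ⟩
    x - 1#                     ∎
    where
    h : ℝ
    h = (x - 1#) / fromℕ (suc m)
    0≤h : 0# ≤ h
    0≤h = *-nonNeg (x+y≤z⇒x≤z-y (≤-trans (≤-reflexive (+-identityˡ 1#)) 1≤x)) (0≤⁻¹ (0<fromℕ m))
    term : ∀ k → h / (1# + fromℕ k * h) ≤ h
    term k = x≤z*y⇒x/y≤z (1≤⇒0< 1≤d) (begin
      h                       ≈⟨ *-identityʳ h ⟨
      h * 1#                  ≤⟨ *-monoʳ-≤ 0≤h 1≤d ⟩
      h * (1# + fromℕ k * h)  ∎)
      where
      1≤d : 1# ≤ 1# + fromℕ k * h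
      1≤d = 0≤y⇒x≤x+y 1# (*-nonNeg (0≤fromℕ k) 0≤h)

  -- With m + 1 equal steps of length h ≥ 1, the k-th term h/(1 + k h) is at least 1/(1 + k).
  harmonic≤log : ∀ m {x} → fromℕ (2 ℕ.+ m) ≤ x → harmonic (suc m) ≤ log x
  harmonic≤log m {x} 2+m≤x = begin
    harmonic (suc m)  ≤⟨ sum-mono-≤ {suc m} (λ i → term (suc (toℕ i))) ⟩
    lowerSum x m      ≤⟨ sup-upper _ (_ , m , refl)
                           (x - 1# , λ { y (m′ , y≈) → ≤-trans (≤-reflexive y≈) (lowerSum≤x-1 1≤x m′) }) _ (m , refl) ⟩
    log x             ∎
    where
    h : ℝ
    h = (x - 1#) / fromℕ (suc m)
    1≤x : 1# ≤ x
    1≤x = ≤-trans (0≤y⇒x≤x+y 1# (0≤fromℕ (suc m))) 2+m≤x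
    1≤h : 1# ≤ h
    1≤h = z*y≤x⇒z≤x/y (0<fromℕ m) (x+y≤z⇒x≤z-y (begin
      1# * fromℕ (suc m) + 1#  ≈⟨ solve 1 (λ n → con 1 :* n :+ con 1 := con 1 :+ n) refl (fromℕ (suc m)) ⟩
      fromℕ (2 ℕ.+ m)          ≤⟨ 2+m≤x ⟩
      x                        ∎))
    0≤h : 0# ≤ h
    0≤h = ≤-trans 0≤1 1≤h
    term : ∀ k → fromℕ (suc k) ⁻¹ ≤ h / (1# + fromℕ k * h)
    term k = z*y≤x⇒z≤x/y (1≤⇒0< (0≤y⇒x≤x+y 1# (*-nonNeg (0≤fromℕ k) 0≤h))) (begin
      k+1 ⁻¹ * (1# + fromℕ k * h)  ≤⟨ *-monoʳ-≤ (0≤⁻¹ (0<fromℕ k)) (+-monoˡ-≤ (fromℕ k * h) 1≤h) ⟩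
      k+1 ⁻¹ * (h + fromℕ k * h)
        ≈⟨ solve 3 (λ i h k → i :* (h :+ k :* h) := (h :* (con 1 :+ k)) :* i) refl (k+1 ⁻¹) h (fromℕ k) ⟩
      (h * k+1) / k+1              ≈⟨ x*y/y≈x h (0<fromℕ k) ⟩
      h                            ∎)
      where
      k+1 : ℝ
      k+1 = fromℕ (suc k)

  log-unbounded : ∀ c → ∃[ N ] (∀ {x} → fromℕ N ≤ x → fromℕ c ≤ log x)
  log-unbounded c with harmonic-unbounded c
  ... | m , c≤ = 2 ℕ.+ m , λ 2+m≤x → ≤-trans c≤ (harmonic≤log m 2+m≤x)

-- Counting elements of `A` above b and locating a gap.

module Gap (em : ExcludedMiddle 0ℓ) (reals : CompleteOrderedField) (A : Pred ℕ 0ℓ)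
  (n₀ : ℕ) (r≢1 : ∀ n → n₀ ≤ℕ n → r em A n ≢ 1)
  (a₀ : ℕ) (a₀∈A : a₀ ∈ A) (n₀≤a₀ : n₀ ≤ℕ a₀) where

  open OrderedField em reals
  open Cardinality em {ℕ}
  open NoUniqueSums em A n₀ r≢1

  -- For a₀ = 0, `next` would give an element v with 0 < v ≤ 0.
  0<a₀ : 0 <ℕ a₀
  0<a₀ with next a₀∈A n₀≤a₀
  ... | v , _ , a₀<v , v≤2a₀ = ℕₚ.+-cancelˡ-< a₀ 0 a₀ (ℕₚ.<-≤-trans (≡.subst (_<ℕ v) (≡.sym (ℕₚ.+-identityʳ a₀)) a₀<v) v≤2a₀)

  -- Comparing cardinalities needs finiteness, since `card` is 0 on infinite sets; an upper bound in
  -- the reals gives one in the naturals.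
  finite : ∀ (I : Pred ℝ 0ℓ) {x} → (∀ {t} → t ∈ I → t ≤ x) → Finite (A ⋒ I)
  finite _ {x} I≤x with archimedean x
  ... | N , x<N = bounded⇒finite em N λ (_ , k∈I) → fromℕ-cancel-< (≤-<-trans (I≤x k∈I) x<N)

  x≤x+y : ∀ x {y} → 0# < y → x ≤ x + y
  x≤x+y x 0<y = 0≤y⇒x≤x+y x (<⇒≤ 0<y)

  fromℕ-double : ∀ {m} n → m ≤ℕ n ℕ.+ n → fromℕ m ≤ fromℕ n + fromℕ n
  fromℕ-double {m} n m≤2n = ≤-trans (fromℕ-mono-≤ m≤2n) (≤-reflexive (fromℕ-+ n n))

  module _ (b : ℝ) (a₀≤b : fromℕ a₀ ≤ b) where

    0<b : 0# < b
    0<b = <-≤-trans (fromℕ-mono-< 0<a₀) a₀≤b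

    multiple-mono : ∀ {m n} → m ≤ℕ n → fromℕ m * b ≤ fromℕ n * b
    multiple-mono m≤n = *-monoˡ-≤ (<⇒≤ 0<b) (fromℕ-mono-≤ m≤n)

    double : ∀ {x} → x ≤ b → x + x ≤ fromℕ 2 * b
    double {x} x≤b = begin
      x + x        ≤⟨ +-mono-≤ x≤b x≤b ⟩
      b + b        ≈⟨ solve 1 (λ b → b :+ b := (con 1 :+ (con 1 :+ con 0)) :* b) refl b ⟩
      fromℕ 2 * b  ∎

    count : ℕ → ℕ
    count c = card em (A ⋒ ⟨ b , fromℕ c ])

    count-mono-< : ∀ {q c} → c ∈ A → b < fromℕ c → q <ℕ c → count q <ℕ count c
    count-mono-< {q} {c} c∈A b<c q<c = card-mono-< {A ⋒ ⟨ b , fromℕ q ]} (finite ⟨ b , fromℕ c ] proj₂)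
      (λ (k∈A , b<k , k≤q) → k∈A , b<k , ≤-trans k≤q (fromℕ-mono-≤ (ℕₚ.<⇒≤ q<c)))
      (c∈A , b<c , ≤-refl)
      (λ (_ , _ , c≤q) → ℕₚ.<⇒≱ q<c (fromℕ-cancel-≤ c≤q))

    -- The estimate count c ≥ c/b - 1 with the division cleared.
    Dense : ℕ → Set
    Dense c = fromℕ c ≤ fromℕ (suc (count c)) * b

    Good : ℕ → Set
    Good a = a ∈ A × fromℕ 3 * b < fromℕ a
      × Empty (A ⋒ [ fromℕ a - b , fromℕ a ⟩)
      × (fromℕ a + b) / (fromℕ 2 * b) - 1# ≤ fromℕ (card em (A ⋒ ⟨ b , fromℕ a + b ]))

    point-in-⟨b,2b] : ∃[ e ] e ∈ A × b < fromℕ e × fromℕ e ≤ fromℕ 2 * b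
    point-in-⟨b,2b] with archimedean b
    ... | N , b<N with crossing {λ k → fromℕ k ≤ b} N (λ k≤b → fromℕ-cancel-< (≤-<-trans k≤b b<N)) a₀∈A n₀≤a₀ a₀≤b
    ... | p , v , (_ , p≤b) , (v∈A , v≰b) , v≤2p = v , v∈A , ≰⇒> v≰b , ≤-trans (fromℕ-double p v≤2p) (double p≤b)

    dense-≤2b : ∀ {c} → c ∈ A → b < fromℕ c → fromℕ c ≤ fromℕ 2 * b → Dense c
    -- Comparison with `a₀` only serves to show count c ≥ 1; the element counted is c itself.
    dense-≤2b {c} c∈A b<c c≤2b = ≤-trans c≤2b (multiple-mono (s≤s (ℕₚ.≤-trans (s≤s z≤n) (count-mono-< c∈A b<c a₀<c))))
      where
      a₀<c : a₀ <ℕ c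
      a₀<c = fromℕ-cancel-< (≤-<-trans a₀≤b b<c)

    -- Two elements are counted: some e in (b, 2b], and c > 2b.
    dense-≤3b : ∀ {c} → c ∈ A → ¬ fromℕ c ≤ fromℕ 2 * b → fromℕ c ≤ fromℕ 3 * b → Dense c
    dense-≤3b {c} c∈A c≰2b c≤3b with point-in-⟨b,2b]
    ... | e , e∈A , b<e , e≤2b = ≤-trans c≤3b (multiple-mono (s≤s (ℕₚ.≤-trans
      (s≤s (ℕₚ.≤-trans (s≤s z≤n) (count-mono-< e∈A b<e a₀<e)))
      (count-mono-< c∈A (<-≤-trans b<e (fromℕ-mono-≤ (ℕₚ.<⇒≤ e<c))) e<c))))
      where
      a₀<e : a₀ <ℕ e
      a₀<e = fromℕ-cancel-< (≤-<-trans a₀≤b b<e)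
      e<c : e <ℕ c
      e<c = fromℕ-cancel-< (≤-<-trans e≤2b (≰⇒> c≰2b))

    -- Passing from q to c adds at most b to the left side, while c is a newly counted element.
    dense-step : ∀ {q c} → c ∈ A → b < fromℕ c → q <ℕ c → fromℕ c ≤ fromℕ q + b → Dense q → Dense c
    dense-step {q} {c} c∈A b<c q<c c≤q+b dense = begin
      fromℕ c                                 ≤⟨ c≤q+b ⟩
      fromℕ q + b                             ≤⟨ +-mono-≤ dense ≤-refl ⟩
      fromℕ (suc (count q)) * b + b
        ≈⟨ solve 2 (λ n b → n :* b :+ b := (con 1 :+ n) :* b) refl (fromℕ (suc (count q))) b ⟩
      fromℕ (suc (suc (count q))) * b         ≤⟨ multiple-mono (s≤s (count-mono-< c∈A b<c q<c)) ⟩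
      fromℕ (suc (count c)) * b               ∎

    -- Keeps the walk above b: below an element c > 3b, it moves to an element q with either c ≤ q +
    -- b or c ≤ 2q, and q ≤ b would give c ≤ 2b in both cases.
    >3b⇒>b : ∀ {c q} → fromℕ 3 * b < c → (q ≤ b → c ≤ fromℕ 2 * b) → b < q
    >3b⇒>b 3b<c c≤2b = ≰⇒> λ q≤b → <⇒≱ 3b<c (≤-trans (c≤2b q≤b) (multiple-mono (ℕₚ.n≤1+n 2)))

    gap-good : ∀ {a p} → a ∈ A → fromℕ 3 * b < fromℕ a → Empty (A ⋒ [ fromℕ a - b , fromℕ a ⟩) →
      p <ℕ a → a ≤ℕ p ℕ.+ p → Dense p → Good a
    gap-good {a} {p} a∈A 3b<a empty p<a a≤2p dense = a∈A , 3b<a , empty ,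
      x≤z+y⇒x-y≤z (x≤z*y⇒x/y≤z 0<2b (begin
        -- One extra b is given away here so that the final bound is a multiple of 2b.
        fromℕ a + b                            ≤⟨ +-mono-≤ (fromℕ-double p a≤2p) (x≤x+y b 0<b) ⟩
        fromℕ p + fromℕ p + (b + b)
          ≤⟨ +-mono-≤ (+-mono-≤ p≤nb p≤nb) ≤-refl ⟩
        n * b + n * b + (b + b)
          ≈⟨ solve 2 (λ n b → n :* b :+ n :* b :+ (b :+ b) := (n :+ con 1) :* ((con 1 :+ (con 1 :+ con 0)) :* b)) refl n b ⟩
        (n + 1#) * (fromℕ 2 * b)               ∎))
      where
      n : ℝ
      n = fromℕ (card em (A ⋒ ⟨ b , fromℕ a + b ]))
      b≤2b : b ≤ fromℕ 2 * b
      b≤2b = ≤-trans (x≤x+y b 0<b) (double ≤-refl)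
      b<a : b < fromℕ a
      b<a = >3b⇒>b 3b<a λ a≤b → ≤-trans a≤b b≤2b
      0<2b : 0# < fromℕ 2 * b
      0<2b = <-≤-trans 0<b b≤2b
      -- The element a is counted by n but not by `count p`, which absorbs the 1 added in `Dense p`.
      p≤nb : fromℕ p ≤ n * b
      p≤nb = ≤-trans dense (multiple-mono (ℕₚ.≤-trans (count-mono-< a∈A b<a p<a)
        (card-mono {A ⋒ ⟨ b , fromℕ a ]} (finite ⟨ b , fromℕ a + b ] proj₂)
          λ (k∈A , b<k , k≤a) → k∈A , b<k , ≤-trans k≤a (x≤x+y (fromℕ a) 0<b))))

    Outcome : ℕ → Set
    Outcome c = c ∈ A → b < fromℕ c → Dense c ⊎ ∃[ a ] a ≤ℕ c × Good a

    -- Strong induction, descending before judging c: a gap below c is used only when the element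
    -- under it is already dense. The bound a ≤ c is carried along so that a + b < x can be derived
    -- at the end.
    dense-or-good : ∀ c → Outcome c
    dense-or-good = <-rec Outcome step
      where
      step : ∀ c → (∀ {q} → q <ℕ c → Outcome q) → Outcome c
      step c rec c∈A b<c with em {fromℕ c ≤ fromℕ 2 * b} | em {fromℕ c ≤ fromℕ 3 * b}
      ... | yes c≤2b | _        = inj₁ (dense-≤2b c∈A b<c c≤2b)
      ... | no  c≰2b | yes c≤3b = inj₁ (dense-≤3b c∈A c≰2b c≤3b)
      ... | no  c≰2b | no  c≰3b with em {∃[ q ] q ∈ (A ⋒ [ fromℕ c - b , fromℕ c ⟩)}
      ... | yes (q , q∈A , c-b≤q , q<c) = continue (rec (fromℕ-cancel-< q<c) q∈A b<q)
        where
        c≤q+b : fromℕ c ≤ fromℕ q + b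
        c≤q+b = ≤-trans (≤-reflexive (sym (x-y+y≈x (fromℕ c) b))) (+-monoˡ-≤ b c-b≤q)
        b<q : b < fromℕ q
        b<q = >3b⇒>b (≰⇒> c≰3b) λ q≤b → ≤-trans c≤q+b (≤-trans (+-monoˡ-≤ b q≤b) (double ≤-refl))
        continue : Dense q ⊎ (∃[ a ] a ≤ℕ q × Good a) → Dense c ⊎ ∃[ a ] a ≤ℕ c × Good a
        continue (inj₁ dense)          = inj₁ (dense-step {q} c∈A b<c (fromℕ-cancel-< q<c) c≤q+b dense)
        continue (inj₂ (a , a≤q , ok)) = inj₂ (a , ℕₚ.≤-trans a≤q (ℕₚ.<⇒≤ (fromℕ-cancel-< q<c)) , ok)
      -- A gap lies below c. Crossing c yields p in `A` with p < c ≤ 2p, and if p is dense then c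
      -- itself is the required element.
      ... | no  empty with crossing {_<ℕ c} c (λ k<c → k<c) a₀∈A n₀≤a₀ (fromℕ-cancel-< (≤-<-trans a₀≤b b<c))
      ... | p , v , (p∈A , p<c) , (_ , v≮c) , v≤2p = continue (rec p<c p∈A b<p)
        where
        c≤2p : c ≤ℕ p ℕ.+ p
        c≤2p = ℕₚ.≤-trans (ℕₚ.≮⇒≥ v≮c) v≤2p
        b<p : b < fromℕ p
        b<p = >3b⇒>b (≰⇒> c≰3b) λ p≤b → ≤-trans (fromℕ-double p c≤2p) (double p≤b)
        continue : Dense p ⊎ (∃[ a ] a ≤ℕ p × Good a) → Dense c ⊎ ∃[ a ] a ≤ℕ c × Good a
        continue (inj₁ dense)          = inj₂ (c , ℕₚ.≤-refl , gap-good c∈A (≰⇒> c≰3b) (λ q q∈ → empty (q , q∈)) p<c c≤2p dense)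
        continue (inj₂ (a , a≤p , ok)) = inj₂ (a , ℕₚ.≤-trans a≤p (ℕₚ.<⇒≤ p<c) , ok)

    -- Crossing the threshold k + b < x: the element v reached next has x ≤ v + b and v ≤ 2c.
    last-below : ∀ {x} → fromℕ a₀ + b < x → ∃[ c ] c ∈ A × fromℕ c + b < x × x ≤ fromℕ c + fromℕ c + b
    last-below {x} a₀+b<x with archimedean x
    ... | N , x<N with crossing {λ k → fromℕ k + b < x} N below a₀∈A n₀≤a₀ a₀+b<x
      where
      below : ∀ {k} → fromℕ k + b < x → k <ℕ N
      below {k} k+b<x = fromℕ-cancel-< (≤-<-trans (x≤x+y (fromℕ k) 0<b) (<-≤-trans k+b<x (<⇒≤ x<N)))
    ... | c , v , (c∈A , c+b<x) , (_ , v+b≮x) , v≤2c =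
      c , c∈A , c+b<x , ≤-trans (≮⇒≥ v+b≮x) (+-monoˡ-≤ b (fromℕ-double c v≤2c))

    -- Sparseness against density, with `L` and `ℓ` standing for log x and log log x.

    module _ {x L ℓ : ℝ} (3≤L : fromℕ 3 ≤ L) (2≤ℓ : fromℕ 2 ≤ ℓ)
      (b≤x/L² : b ≤ x / L ^ 2) (sparse : fromℕ (card em (A ⟨≤ x ⟩)) ≤ (L / ℓ) ^ 2) where

      private
        M = fromℕ (card em (A ⟨≤ x ⟩))

      0≤L : 0# ≤ L
      0≤L = ≤-trans (0≤fromℕ 3) 3≤L

      -- The constant 9 serves twice: x ≥ 9b makes room for a₀ + b ≤ 2b ≤ 3b < x, and 9 > 6 closes
      -- `not-dense`.
      9≤L² : fromℕ 9 ≤ L ^ 2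
      9≤L² = begin
        fromℕ 9            ≈⟨ fromℕ-* 3 3 ⟩
        fromℕ 3 * fromℕ 3  ≤⟨ *-mono-≤ 0≤L (0≤fromℕ 3) 3≤L 3≤L ⟩
        L * L              ≈⟨ *-congˡ (*-identityʳ L) ⟨
        L ^ 2              ∎

      bL²≤x : b * L ^ 2 ≤ x
      bL²≤x = z≤x/y⇒z*y≤x (<-≤-trans (0<fromℕ 8) 9≤L²) b≤x/L²

      9b≤x : fromℕ 9 * b ≤ x
      9b≤x = begin
        fromℕ 9 * b ≤⟨ *-monoˡ-≤ (<⇒≤ 0<b) 9≤L² ⟩
        L ^ 2 * b   ≈⟨ *-comm (L ^ 2) b ⟩
        b * L ^ 2   ≤⟨ bL²≤x ⟩
        x           ∎

      3b<x : fromℕ 3 * b < x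
      3b<x = ≰⇒> λ x≤3b → contradiction (fromℕ-cancel-≤ (*-cancelʳ-≤ 0<b (≤-trans 9b≤x x≤3b))) (from-no (9 ℕₚ.≤? 3))

      -- 4 M ≤ 4 (L/ℓ)² ≤ L², hence 2 L² ≤ 6 + 4 M ≤ 6 + L² and 9 ≤ L² ≤ 6.
      not-dense : ¬ x ≤ (fromℕ 3 + fromℕ 2 * M) * b
      not-dense x≤ = contradiction (fromℕ-cancel-≤ (≤-trans 9≤L² L²≤6)) (from-no (9 ℕₚ.≤? 6))
        where
        K : ℝ
        K = L / ℓ
        0<ℓ : 0# < ℓ
        0<ℓ = <-≤-trans (0<fromℕ 1) 2≤ℓ
        0≤K : 0# ≤ K
        0≤K = *-nonNeg 0≤L (0≤⁻¹ 0<ℓ)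
        0≤K2 : 0# ≤ K * fromℕ 2
        0≤K2 = *-nonNeg 0≤K (0≤fromℕ 2)
        K2≤L : K * fromℕ 2 ≤ L
        K2≤L = ≤-trans (*-monoʳ-≤ 0≤K 2≤ℓ) (≤-reflexive (x/y*y≈x L 0<ℓ))
        L²≤3+2M : L ^ 2 ≤ fromℕ 3 + fromℕ 2 * M
        L²≤3+2M = *-cancelʳ-≤ 0<b (≤-trans (≤-reflexive (*-comm (L ^ 2) b)) (≤-trans bL²≤x x≤))
        4M≤L² : fromℕ 2 * (fromℕ 2 * M) ≤ L ^ 2
        4M≤L² = begin
          fromℕ 2 * (fromℕ 2 * M)                ≤⟨ *-monoʳ-≤ (0≤fromℕ 2) (*-monoʳ-≤ (0≤fromℕ 2) sparse) ⟩
          fromℕ 2 * (fromℕ 2 * (K * (K * 1#)))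
            ≈⟨ solve 2 (λ t k → t :* (t :* (k :* (k :* con 1))) := (k :* t) :* (k :* t)) refl (fromℕ 2) K ⟩
          (K * fromℕ 2) * (K * fromℕ 2)          ≤⟨ *-mono-≤ 0≤L 0≤K2 K2≤L K2≤L ⟩
          L * L                                  ≈⟨ *-congˡ (*-identityʳ L) ⟨
          L ^ 2                                  ∎
        L²≤6 : L ^ 2 ≤ fromℕ 6
        L²≤6 = +-cancelʳ-≤ (L ^ 2) (begin
          L ^ 2 + L ^ 2                          ≈⟨ solve 1 (λ y → y :+ y := (con 1 :+ (con 1 :+ con 0)) :* y) refl (L ^ 2) ⟩
          fromℕ 2 * L ^ 2                        ≤⟨ *-monoʳ-≤ (0≤fromℕ 2) L²≤3+2M ⟩
          fromℕ 2 * (fromℕ 3 + fromℕ 2 * M)      ≈⟨ distribˡ (fromℕ 2) (fromℕ 3) (fromℕ 2 * M) ⟩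
          fromℕ 2 * fromℕ 3 + fromℕ 2 * (fromℕ 2 * M)
            ≤⟨ +-mono-≤ (≤-reflexive (sym (fromℕ-* 2 3))) 4M≤L² ⟩
          fromℕ 6 + L ^ 2                        ∎)

      b<last : ∀ {c} → x ≤ c + c + b → b < c
      b<last {c} x≤2c+b = ≰⇒> λ c≤b → <⇒≱ 3b<x (begin
        x                ≤⟨ x≤2c+b ⟩
        c + c + b        ≤⟨ +-monoˡ-≤ b (double c≤b) ⟩
        fromℕ 2 * b + b  ≈⟨ solve 2 (λ t b → t :* b :+ b := (con 1 :+ t) :* b) refl (fromℕ 2) b ⟩
        fromℕ 3 * b      ∎)

      -- The elements of `A` in (b, c] all lie in A(x), so density gives c ≤ (1 + M)b and hence x ≤
      -- 2c + b ≤ (3 + 2M)b.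
      last-not-dense : ∀ c → fromℕ c + b < x → x ≤ fromℕ c + fromℕ c + b → ¬ Dense c
      last-not-dense c c+b<x x≤2c+b dense = not-dense (begin
        x                              ≤⟨ x≤2c+b ⟩
        fromℕ c + fromℕ c + b          ≤⟨ +-monoˡ-≤ b (+-mono-≤ c≤ c≤) ⟩
        (1# + M) * b + (1# + M) * b + b
          ≈⟨ regroup M ⟩
        (fromℕ 3 + fromℕ 2 * M) * b    ∎)
        where
        regroup : ∀ m → (1# + m) * b + (1# + m) * b + b ≈ (fromℕ 3 + fromℕ 2 * m) * b
        regroup m = solve 2 (λ m b → (con 1 :+ m) :* b :+ (con 1 :+ m) :* b :+ b
          := (con 1 :+ (con 1 :+ (con 1 :+ con 0)) :+ (con 1 :+ (con 1 :+ con 0)) :* m) :* b) refl m b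
        below-c : ∀ {k} → k ∈ (A ⋒ ⟨ b , fromℕ c ]) → k ∈ (A ⟨≤ x ⟩)
        below-c (k∈A , _ , k≤c) = k∈A , ≤-trans k≤c (≤-trans (x≤x+y (fromℕ c) 0<b) (<⇒≤ c+b<x))
        c≤ : fromℕ c ≤ (1# + M) * b
        c≤ = ≤-trans dense (multiple-mono (s≤s (card-mono {A ⋒ ⟨ b , fromℕ c ]} (finite (_≤ x) λ t≤x → t≤x) below-c)))

      a₀+b<x : fromℕ a₀ + b < x
      a₀+b<x = ≤-<-trans (≤-trans (+-mono-≤ a₀≤b ≤-refl) (≤-trans (double ≤-refl) (multiple-mono (ℕₚ.n≤1+n 2)))) 3b<x

      good-below-x : ∃[ a ] Good a × fromℕ a + b < x
      good-below-x =
        let c , c∈A , c+b<x , x≤2c+b = last-below a₀+b<x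
        in conclude c c+b<x x≤2c+b (dense-or-good c c∈A (b<last x≤2c+b))
        where
        conclude : ∀ c → fromℕ c + b < x → x ≤ fromℕ c + fromℕ c + b →
          Dense c ⊎ (∃[ a ] a ≤ℕ c × Good a) → ∃[ a ] Good a × fromℕ a + b < x
        conclude c c+b<x x≤2c+b (inj₁ dense)            = contradiction dense (last-not-dense c c+b<x x≤2c+b)
        conclude c c+b<x x≤2c+b (inj₂ (a , a≤c , good)) = a , good , ≤-<-trans (+-monoˡ-≤ b (fromℕ-mono-≤ a≤c)) c+b<x

lemma2p2 : (em : ExcludedMiddle 0ℓ) (reals : CompleteOrderedField) →
    let open CompleteOrderedField reals in
    (A : Pred ℕ 0ℓ) → Infinite A →
    (n₀ : ℕ) → (∀ n → n₀ ≤ℕ n → r em A n ≢ 1) →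
    (a₀ : ℕ) → a₀ ∈ A → n₀ ≤ℕ a₀ →
    ∃[ x₀ ] ∀ (x : ℝ) → x₀ ≤ x →
    fromℕ (card em (A ⟨≤ x ⟩)) ≤ (log x / log (log x)) ^ 2 →
    ∀ (b : ℝ) → fromℕ a₀ ≤ b → b ≤ x / (log x) ^ 2 →
    ∃[ a ] a ∈ A
    × fromℕ 3 * b < fromℕ a
    × fromℕ a + b < x
    × Empty (A ⋒ [ fromℕ a - b , fromℕ a ⟩)
    × (fromℕ a + b) / (fromℕ 2 * b) - 1# ≤ fromℕ (card em (A ⋒ ⟨ b , fromℕ a + b ]))
lemma2p2 em reals A _ n₀ r≢1 a₀ a₀∈A n₀≤a₀ = fromℕ N₁ , λ x N₁≤x sparse b a₀≤b b≤x/L² →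
  let c≤L = log≥c N₁≤x
      3≤L = ≤-trans (fromℕ-mono-≤ (ℕₚ.m≤n⊔m N₂ 3)) c≤L
      2≤ℓ = log≥2 (≤-trans (fromℕ-mono-≤ (ℕₚ.m≤m⊔n N₂ 3)) c≤L)
      (a , (a∈A , 3b<a , empty , many) , a+b<x) = good-below-x b a₀≤b 3≤L 2≤ℓ b≤x/L² sparse
  in a , a∈A , 3b<a , a+b<x , empty , many
  where
  open OrderedField em reals
  open Gap em reals A n₀ r≢1 a₀ a₀∈A n₀≤a₀
  N₂ : ℕ
  N₂ = proj₁ (log-unbounded 2)
  log≥2 : ∀ {x} → fromℕ N₂ ≤ x → fromℕ 2 ≤ log x
  log≥2 = proj₂ (log-unbounded 2)
  -- From `N₁` on, log x is at least both 3 and `N₂`, and the latter makes log log x at least 2.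
  N₁ : ℕ
  N₁ = proj₁ (log-unbounded (N₂ ℕ.⊔ 3))
  log≥c : ∀ {x} → fromℕ N₁ ≤ x → fromℕ (N₂ ℕ.⊔ 3) ≤ log x
  log≥c = proj₂ (log-unbounded (N₂ ℕ.⊔ 3))
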